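{- Let $A,B\in\mathbb{Q}$ with $AB\neq 0$. (1) If $x^6+Ax^3+B$ has reducibility type $(2,2,2)$, then up to scaling $$A=-27u(u+1),\qquad B=27(u^2+u+1)^3$$ for some $u\in\mathbb{Q}$, $u\neq0,-1,-\tfrac12$, with $$x^6-27u(u+1)x^3+27(u^2+u+1)^3=\bigl(x^2+3x+3(u^2+u+1)\bigr)\bigl(x^2-3(u+1)x+3(u^2+u+1)\bigr)\bigl(x^2+3ux+3(u^2+u+1)\bigr).$$ (2) If $x^6+Ax^3+B$ has reducibility type $(1,1,2,2)$, then up to scaling $A=-u^3-1$, $B=u^3$ for some $u\in\mathbb{Q}$, $u\neq0,-1$, and $$x^6+Ax^3+B=(x-1)(x-u)(x^2+x+1)(x^2+ux+u^2).$$ (3) There are no trinomials $x^6+Ax^3+B$ of reducibility type $(1,1,1,1,2)$. (4) If $x^6+Ax^3+B$ has reducibility type $(1,2,3)$, then up to scaling $(A,B)=(t-1,-t)$ for some $t\in\mathbb{Q}$ that is not the cube of a rational number, and $$x^6+(t-1)x^3-t=(x-1)(x^2+x+1)(x^3+t).$$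
   Context: A monic polynomial in $\mathbb{Q}[x]$ has reducibility type $(n_1,\dots,n_k)$, $n_1\le\dots\le n_k$, if it factors as a product of $k$ irreducible polynomials in $\mathbb{Q}[x]$ (not necessarily distinct) of degrees $n_1,\dots,n_k$. Trinomials are considered up to scaling: $x^n+Ax^m+B$ and $x^n+A\lambda^{n-m}x^m+B\lambda^n$ are identified for $\lambda\in\mathbb{Q}\setminus\{0\}$; "up to scaling $(A,B)=(A_0,B_0)$" means $(A,B)=(A_0\lambda^{n-m},B_0\lambda^n)$ for some $\lambda\in\mathbb{Q}\setminus\{0\}$ (and the factorization is that of the scaled trinomial). -}

module Defs where

open import Algebra.Bundles using (RawSemiring)
open import Data.List using (List; []; _∷_; _++_; map; replicate; foldr)
open import Data.List.Relation.Binary.Pointwise using (Pointwise)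
open import Data.List.Relation.Unary.Linked using (Linked)
open import Data.Nat using (ℕ; zero; suc; _∸_; _≤_; _<_)
open import Data.Integer using (+_)
open import Data.Product using (_×_; ∃-syntax)
open import Data.Rational using (ℚ; 0ℚ; 1ℚ; _+_; _*_; -_; _/_; +-*-rawSemiring)
open import Level using (0ℓ)
open import Relation.Binary.PropositionalEquality using (_≡_; _≢_)

import Algebra.Definitions.RawSemiring as RawSemiringDefinitions

open RawSemiringDefinitions +-*-rawSemiring public using (_^_)

3ℚ : ℚ
3ℚ = + 3 / 1

27ℚ : ℚ
27ℚ = + 27 / 1

-- Coefficients in ascending order of degree. Trailing zeros are allowed, so
-- equality of polynomials is _≈ₚ_ below, not propositional equality.
Poly : Set
Poly = List ℚ

coeff : Poly → ℕ → ℚ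
coeff []      _       = 0ℚ
coeff (a ∷ p) zero    = a
coeff (a ∷ p) (suc n) = coeff p n

infix 4 _≈ₚ_
_≈ₚ_ : Poly → Poly → Set
p ≈ₚ q = ∀ n → coeff p n ≡ coeff q n

infixl 6 _+ₚ_ _-ₚ_
infixl 7 _*ₚ_

_+ₚ_ : Poly → Poly → Poly
[]      +ₚ q       = q
(a ∷ p) +ₚ []      = a ∷ p
(a ∷ p) +ₚ (b ∷ q) = (a + b) ∷ (p +ₚ q)

_-ₚ_ : Poly → Poly → Poly
p -ₚ q = p +ₚ map -_ q

_*ₚ_ : Poly → Poly → Poly
[]      *ₚ q = []
(a ∷ p) *ₚ q = map (a *_) q +ₚ (0ℚ ∷ p *ₚ q)

infix 8 _·X^_ X^_

_·X^_ : ℚ → ℕ → Poly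
a ·X^ n = replicate n 0ℚ ++ (a ∷ [])

X^_ : ℕ → Poly
X^ n = 1ℚ ·X^ n

const : ℚ → Poly
const a = a ·X^ 0

ℚ[X] : RawSemiring 0ℓ 0ℓ
ℚ[X] = record
  { Carrier = Poly
  ; _≈_     = _≈ₚ_
  ; _+_     = _+ₚ_
  ; _*_     = _*ₚ_
  ; 0#      = []
  ; 1#      = const 1ℚ
  }

open RawSemiringDefinitions ℚ[X] public using (Irreducible)

HasDegree : Poly → ℕ → Set
HasDegree p n = coeff p n ≢ 0ℚ × (∀ m → n < m → coeff p m ≡ 0ℚ)

Monic : Poly → Set
Monic p = ∃[ n ] HasDegree p n × coeff p n ≡ 1ℚ

productₚ : List Poly → Poly
productₚ = foldr _*ₚ_ (const 1ℚ)

record HasReducibilityType (p : Poly) (ns : List ℕ) : Set where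
  field
    monic       : Monic p
    ordered     : Linked _≤_ ns
    factors     : List Poly
    irreducible : Pointwise (λ f n → Irreducible f × HasDegree f n) factors ns
    factorizes  : p ≈ₚ productₚ factors

trinomial : ℕ → ℕ → ℚ → ℚ → Poly
trinomial n m A B = X^ n +ₚ A ·X^ m +ₚ const B

-- The trinomials x^n + A x^m + B and x^n + A₀ x^m + B₀, where m < n, agree up
-- to scaling.
EqualUpToScaling : (n m : ℕ) (A B A₀ B₀ : ℚ) → Set
EqualUpToScaling n m A B A₀ B₀ =
  ∃[ s ] s ≢ 0ℚ × A ≡ A₀ * s ^ (n ∸ m) × B ≡ B₀ * s ^ n

{-# OPTIONS --safe #-}
module Submission where

-- Parts (2)-(4). A linear factor gives a root r ≠ 0 of T = x⁶ + A x³ + B, and the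
-- cofactor T / (x - r), evaluated at any s, equals (r² + r s + s²)(A + r³ + s³).
-- The first factor is nonzero over ℚ, so a root s of the cofactor satisfies
-- A = -(r³ + s³), B = r³ s³, and T = (x - r)(x - s)(x² + r x + r²)(x² + s x + s²),
-- whose quadratic factors have no rational roots. Scaling r to 1 gives (2); a third
-- root is impossible, which is (3); and in (4) a cube t = v³ would give the root
-- -v r of the product of the two irreducible factors of degrees 2 and 3.
--
-- Part (1). Compare coefficients in T = (x² + a x + b)(x² + c x + d)(x² + e x + f).
-- Either b = d = f, which is the stated family after scaling a to 3, or one of
-- b = c e, d = a e, f = a c holds. As a + c + e = 0, the corresponding quadratic
-- then splits: for instance b = c e gives (x - c)(x - e).

open import Defs
open import Algebra.Definitions.RawMagma using (_,_)
open import Algebra.Definitions.RawSemiring ℚ[X] using (_∣_; mkIrred)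
open import Data.Fin.Patterns using (0F; 1F; 2F; 3F; 4F; 5F)
import Data.Integer as ℤ
open import Data.List using (List; []; _∷_; map; _++_; replicate)
open import Data.List.Properties using (map-cong)
open import Data.List.Relation.Binary.Pointwise using ([]; _∷_)
open import Data.Nat as ℕ using (ℕ; zero; suc; z≤n; s≤s)
open import Data.Nat.Properties as ℕ using ()
open import Data.Product using (_×_; ∃-syntax; _,_; proj₁; proj₂)
open import Data.Rational using (ℚ; 0ℚ; 1ℚ; -½; _+_; _*_; _-_; -_; _≤_; _/_; 1/_; nonNegative; nonPositive; ≢-nonZero)
open import Data.Rational.Properties as ℚ using (_≟_)
open import Data.Sum using (_⊎_; inj₁; inj₂; [_,_]′)
open import Data.Vec as Vec using (Vec)
open import Function using (_∘_)
open import Level using (0ℓ)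
open import Relation.Binary.PropositionalEquality using (_≡_; _≢_; refl; sym; trans; cong; cong₂; module ≡-Reasoning)
open import Relation.Nullary using (¬_; yes; no; contradiction)
open import Relation.Nullary.Decidable.Core using (dec⇒maybe)
open import Tactic.RingSolver using (solve-∀)
open import Tactic.RingSolver.Core.AlmostCommutativeRing using (AlmostCommutativeRing; fromCommutativeRing)
open import Algebra.Properties.Group ℚ.+-0-group using (inverseˡ-unique; x∙y⁻¹≈ε⇒x≈y)

-- Rational arithmetic

ℚ-ring : AlmostCommutativeRing 0ℓ 0ℓ
ℚ-ring = fromCommutativeRing ℚ.+-*-commutativeRing (λ x → dec⇒maybe (0ℚ ≟ x))

*-≢0 : ∀ {x y} → x ≢ 0ℚ → y ≢ 0ℚ → x * y ≢ 0ℚ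
*-≢0 {x} {y} x≢0 y≢0 xy≡0 = y≢0 (begin
  y               ≡⟨ ℚ.*-identityˡ y ⟨
  1ℚ * y          ≡⟨ cong (_* y) (ℚ.*-inverseˡ x) ⟨
  1/ x * x * y    ≡⟨ ℚ.*-assoc (1/ x) x y ⟩
  1/ x * (x * y)  ≡⟨ cong (1/ x *_) xy≡0 ⟩
  1/ x * 0ℚ       ≡⟨ ℚ.*-zeroʳ (1/ x) ⟩
  0ℚ              ∎)
  where
  open ≡-Reasoning
  instance _ = ≢-nonZero x≢0

*≡0ʳ : ∀ {x y} → x ≢ 0ℚ → x * y ≡ 0ℚ → y ≡ 0ℚ
*≡0ʳ {y = y} x≢0 xy≡0 with y ≟ 0ℚ
... | yes y≡0 = y≡0
... | no  y≢0 = contradiction xy≡0 (*-≢0 x≢0 y≢0)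

*≡0 : ∀ x {y} → x * y ≡ 0ℚ → x ≡ 0ℚ ⊎ y ≡ 0ℚ
*≡0 x xy≡0 with x ≟ 0ℚ
... | yes x≡0 = inj₁ x≡0
... | no  x≢0 = inj₂ (*≡0ʳ x≢0 xy≡0)

invert : ∀ {x} → x ≢ 0ℚ → ∃[ y ] x * y ≡ 1ℚ
invert {x} x≢0 = 1/ x , ℚ.*-inverseʳ x
  where instance _ = ≢-nonZero x≢0

square-nonneg : ∀ x → 0ℚ ≤ x * x
square-nonneg x with ℚ.≤-total 0ℚ x
... | inj₁ 0≤x = ℚ.nonNegative⁻¹ (x * x) ⦃ ℚ.nonNeg*nonNeg⇒nonNeg x ⦃ nonNegative 0≤x ⦄ x ⦃ nonNegative 0≤x ⦄ ⦄
... | inj₂ x≤0 = ℚ.nonNegative⁻¹ (x * x) ⦃ ℚ.nonPos*nonPos⇒nonPos x ⦃ nonPositive x≤0 ⦄ x ⦃ nonPositive x≤0 ⦄ ⦄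

-- The form is positive definite: four times it is `3x² + (x + 2y)²`, so its vanishing forces
-- `x² ≤ 0`. As `x³ - y³ = (x - y)(x² + x y + y²)`, this expresses that the nontrivial cube roots of
-- unity are irrational.
norm-≢0 : ∀ {x} y → x ≢ 0ℚ → x * x + x * y + y * y ≢ 0ℚ
norm-≢0 {x} y x≢0 N≡0 = *-≢0 x≢0 x≢0 (ℚ.≤-antisym x²≤0 (square-nonneg x))
  where
  open ℚ.≤-Reasoning
  completed : ∀ x y → x * x + (x * x + x * x + (x + y + y) * (x + y + y))
                      ≡ (1ℚ + 1ℚ + 1ℚ + 1ℚ) * (x * x + x * y + y * y)
  completed = solve-∀ ℚ-ring
  x²≤0 : x * x ≤ 0ℚ
  x²≤0 = begin
    x * x                                                  ≡⟨ ℚ.+-identityʳ (x * x) ⟨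
    x * x + 0ℚ                                             ≤⟨ ℚ.+-monoʳ-≤ (x * x)
      (ℚ.+-mono-≤ (ℚ.+-mono-≤ (square-nonneg x) (square-nonneg x)) (square-nonneg (x + y + y))) ⟩
    x * x + (x * x + x * x + (x + y + y) * (x + y + y))    ≡⟨ completed x y ⟩
    (1ℚ + 1ℚ + 1ℚ + 1ℚ) * (x * x + x * y + y * y)          ≡⟨ cong ((1ℚ + 1ℚ + 1ℚ + 1ℚ) *_) N≡0 ⟩
    0ℚ                                                     ∎

x-y≢0 : ∀ {x y} → x ≢ y → x - y ≢ 0ℚ
x-y≢0 {x} {y} x≢y x-y≡0 = x≢y (x∙y⁻¹≈ε⇒x≈y x y x-y≡0)

-- Applies an ideal membership certificate: `k` and `l` are the cofactors that express `z` through
-- quantities known to vanish.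
combine₂ : ∀ {z x y} k l → z ≡ k * x + l * y → x ≡ 0ℚ → y ≡ 0ℚ → z ≡ 0ℚ
combine₂ k l z≡ refl refl = trans z≡ (cong₂ _+_ (ℚ.*-zeroʳ k) (ℚ.*-zeroʳ l))

combine₃ : ∀ {z x y w} k l m → z ≡ k * x + l * y + m * w → x ≡ 0ℚ → y ≡ 0ℚ → w ≡ 0ℚ → z ≡ 0ℚ
combine₃ k l m z≡ refl refl refl =
  trans z≡ (cong₂ _+_ (cong₂ _+_ (ℚ.*-zeroʳ k) (ℚ.*-zeroʳ l)) (ℚ.*-zeroʳ m))

-- Polynomials

coeff-+ : ∀ p q n → coeff (p +ₚ q) n ≡ coeff p n + coeff q n
coeff-+ []      q       n       = sym (ℚ.+-identityˡ (coeff q n))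
coeff-+ (a ∷ p) []      n       = sym (ℚ.+-identityʳ (coeff (a ∷ p) n))
coeff-+ (a ∷ p) (b ∷ q) zero    = refl
coeff-+ (a ∷ p) (b ∷ q) (suc n) = coeff-+ p q n

coeff-scale : ∀ k p n → coeff (map (k *_) p) n ≡ k * coeff p n
coeff-scale k []      n       = sym (ℚ.*-zeroʳ k)
coeff-scale k (a ∷ p) zero    = refl
coeff-scale k (a ∷ p) (suc n) = coeff-scale k p n

-- The Cauchy product on coefficient functions rather than lists. Lists that differ by trailing
-- zeros have pointwise equal coefficient functions, so congruence of `_*ₚ_` reduces to congruence
-- here.
convolution : (ℕ → ℚ) → (ℕ → ℚ) → ℕ → ℚ
convolution f g zero    = f 0 * g 0
convolution f g (suc n) = f 0 * g (suc n) + convolution (f ∘ suc) g n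

convolution-cong : ∀ {f f′ g g′} → (∀ n → f n ≡ f′ n) → (∀ n → g n ≡ g′ n) →
                   ∀ n → convolution f g n ≡ convolution f′ g′ n
convolution-cong f≡ g≡ zero    = cong₂ _*_ (f≡ 0) (g≡ 0)
convolution-cong f≡ g≡ (suc n) =
  cong₂ _+_ (cong₂ _*_ (f≡ 0) (g≡ (suc n))) (convolution-cong (f≡ ∘ suc) g≡ n)

convolution-scale : ∀ k l f g n →
  convolution (λ i → k * f i) (λ i → l * g i) n ≡ k * l * convolution f g n
convolution-scale k l f g zero = identity k l (f 0) (g 0)
  where
  identity : ∀ k l x y → k * x * (l * y) ≡ k * l * (x * y)
  identity = solve-∀ ℚ-ring
convolution-scale k l f g (suc n) =
  trans (cong (k * f 0 * (l * g (suc n)) +_) (convolution-scale k l (f ∘ suc) g n))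
        (identity k l (f 0) (g (suc n)) (convolution (f ∘ suc) g n))
  where
  identity : ∀ k l x y z → k * x * (l * y) + k * l * z ≡ k * l * (x * y + z)
  identity = solve-∀ ℚ-ring

convolution-zeroˡ : ∀ g n → convolution (λ _ → 0ℚ) g n ≡ 0ℚ
convolution-zeroˡ g zero    = ℚ.*-zeroˡ (g 0)
convolution-zeroˡ g (suc n) =
  cong₂ _+_ (ℚ.*-zeroˡ (g (suc n))) (convolution-zeroˡ g n)

coeff-* : ∀ p q n → coeff (p *ₚ q) n ≡ convolution (coeff p) (coeff q) n
coeff-* []      q n       = sym (convolution-zeroˡ (coeff q) n)
coeff-* (a ∷ p) q zero    =
  trans (coeff-+ (map (a *_) q) (0ℚ ∷ p *ₚ q) 0)
        (trans (ℚ.+-identityʳ _) (coeff-scale a q 0))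
coeff-* (a ∷ p) q (suc n) =
  trans (coeff-+ (map (a *_) q) (0ℚ ∷ p *ₚ q) (suc n))
        (cong₂ _+_ (coeff-scale a q (suc n)) (coeff-* p q n))

*ₚ-cong : ∀ {p p′ q q′} → p ≈ₚ p′ → q ≈ₚ q′ → p *ₚ q ≈ₚ p′ *ₚ q′
*ₚ-cong {p} {p′} {q} {q′} p≈p′ q≈q′ n =
  trans (coeff-* p q n) (trans (convolution-cong p≈p′ q≈q′ n) (sym (coeff-* p′ q′ n)))

*ₚ-zeroˡ : ∀ {p} q → p ≈ₚ [] → p *ₚ q ≈ₚ []
*ₚ-zeroˡ {p} q p≈0 n = *ₚ-cong {p} {[]} {q} {q} p≈0 (λ _ → refl) n

scale-cong : ∀ k {p q} → p ≈ₚ q → map (k *_) p ≈ₚ map (k *_) q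
scale-cong k {p} {q} p≈q n =
  trans (coeff-scale k p n) (trans (cong (k *_) (p≈q n)) (sym (coeff-scale k q n)))

*ₚ-scale : ∀ k l p q → map (k *_) p *ₚ map (l *_) q ≈ₚ map (k * l *_) (p *ₚ q)
*ₚ-scale k l p q n = begin
  coeff (map (k *_) p *ₚ map (l *_) q) n                      ≡⟨ coeff-* (map (k *_) p) (map (l *_) q) n ⟩
  convolution (coeff (map (k *_) p)) (coeff (map (l *_) q)) n ≡⟨ convolution-cong (coeff-scale k p) (coeff-scale l q) n ⟩
  convolution (λ i → k * coeff p i) (λ i → l * coeff q i) n   ≡⟨ convolution-scale k l (coeff p) (coeff q) n ⟩
  k * l * convolution (coeff p) (coeff q) n                   ≡⟨ cong (k * l *_) (coeff-* p q n) ⟨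
  k * l * coeff (p *ₚ q) n                                    ≡⟨ coeff-scale (k * l) (p *ₚ q) n ⟨
  coeff (map (k * l *_) (p *ₚ q)) n                           ∎
  where open ≡-Reasoning

scale-1 : ∀ p → map (1ℚ *_) p ≈ₚ p
scale-1 p n = trans (coeff-scale 1ℚ p n) (ℚ.*-identityˡ (coeff p n))

*ₚ-scaleˡ : ∀ k p q → map (k *_) p *ₚ q ≈ₚ map (k *_) (p *ₚ q)
*ₚ-scaleˡ k p q n = begin
  coeff (map (k *_) p *ₚ q) n                ≡⟨ *ₚ-cong {map (k *_) p} {map (k *_) p} (λ _ → refl) (scale-1 q) n ⟨
  coeff (map (k *_) p *ₚ map (1ℚ *_) q) n    ≡⟨ *ₚ-scale k 1ℚ p q n ⟩
  coeff (map (k * 1ℚ *_) (p *ₚ q)) n         ≡⟨ cong (λ l → coeff (map (l *_) (p *ₚ q)) n) (ℚ.*-identityʳ k) ⟩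
  coeff (map (k *_) (p *ₚ q)) n              ∎
  where open ≡-Reasoning

*ₚ-scaleʳ : ∀ k p q → p *ₚ map (k *_) q ≈ₚ map (k *_) (p *ₚ q)
*ₚ-scaleʳ k p q n = begin
  coeff (p *ₚ map (k *_) q) n                ≡⟨ *ₚ-cong {map (1ℚ *_) p} {p} {map (k *_) q} {map (k *_) q} (scale-1 p) (λ _ → refl) n ⟨
  coeff (map (1ℚ *_) p *ₚ map (k *_) q) n    ≡⟨ *ₚ-scale 1ℚ k p q n ⟩
  coeff (map (1ℚ * k *_) (p *ₚ q)) n         ≡⟨ cong (λ l → coeff (map (l *_) (p *ₚ q)) n) (ℚ.*-identityˡ k) ⟩
  coeff (map (k *_) (p *ₚ q)) n              ∎
  where open ≡-Reasoning

-- Evaluation at rational numbers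

eval : Poly → ℚ → ℚ
eval []      r = 0ℚ
eval (a ∷ p) r = a + r * eval p r

eval-zero : ∀ p r → p ≈ₚ [] → eval p r ≡ 0ℚ
eval-zero []      r p≈0 = refl
eval-zero (a ∷ p) r p≈0 =
  cong₂ _+_ (p≈0 0) (trans (cong (r *_) (eval-zero p r (p≈0 ∘ suc))) (ℚ.*-zeroʳ r))

eval-cong : ∀ p q r → p ≈ₚ q → eval p r ≡ eval q r
eval-cong []      q       r p≈q = sym (eval-zero q r (sym ∘ p≈q))
eval-cong (a ∷ p) []      r p≈q = eval-zero (a ∷ p) r p≈q
eval-cong (a ∷ p) (b ∷ q) r p≈q =
  cong₂ (λ x y → x + r * y) (p≈q 0) (eval-cong p q r (p≈q ∘ suc))

eval-+ : ∀ p q r → eval (p +ₚ q) r ≡ eval p r + eval q r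
eval-+ []      q       r = sym (ℚ.+-identityˡ (eval q r))
eval-+ (a ∷ p) []      r = sym (ℚ.+-identityʳ (eval (a ∷ p) r))
eval-+ (a ∷ p) (b ∷ q) r =
  trans (cong (λ x → a + b + r * x) (eval-+ p q r)) (identity a b r (eval p r) (eval q r))
  where
  identity : ∀ a b r x y → a + b + r * (x + y) ≡ a + r * x + (b + r * y)
  identity = solve-∀ ℚ-ring

eval-scale : ∀ k p r → eval (map (k *_) p) r ≡ k * eval p r
eval-scale k []      r = sym (ℚ.*-zeroʳ k)
eval-scale k (a ∷ p) r =
  trans (cong (λ x → k * a + r * x) (eval-scale k p r)) (identity k a r (eval p r))
  where
  identity : ∀ k a r x → k * a + r * (k * x) ≡ k * (a + r * x)
  identity = solve-∀ ℚ-ring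

eval-* : ∀ p q r → eval (p *ₚ q) r ≡ eval p r * eval q r
eval-* []      q r = sym (ℚ.*-zeroˡ (eval q r))
eval-* (a ∷ p) q r = begin
  eval (map (a *_) q +ₚ (0ℚ ∷ p *ₚ q)) r          ≡⟨ eval-+ (map (a *_) q) (0ℚ ∷ p *ₚ q) r ⟩
  eval (map (a *_) q) r + (0ℚ + r * eval (p *ₚ q) r) ≡⟨ cong₂ (λ x y → x + (0ℚ + r * y)) (eval-scale a q r) (eval-* p q r) ⟩
  a * eval q r + (0ℚ + r * (eval p r * eval q r)) ≡⟨ identity a r (eval p r) (eval q r) ⟩
  (a + r * eval p r) * eval q r                   ∎
  where
  open ≡-Reasoning
  identity : ∀ a r x y → a * y + (0ℚ + r * (x * y)) ≡ (a + r * x) * y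
  identity = solve-∀ ℚ-ring

eval-scale-root : ∀ k p r → eval p r ≡ 0ℚ → eval (map (k *_) p) r ≡ 0ℚ
eval-scale-root k p r root =
  trans (eval-scale k p r) (trans (cong (k *_) root) (ℚ.*-zeroʳ k))

eval-*-rootˡ : ∀ p q r → eval p r ≡ 0ℚ → eval (p *ₚ q) r ≡ 0ℚ
eval-*-rootˡ p q r root =
  trans (eval-* p q r) (trans (cong (_* eval q r) root) (ℚ.*-zeroˡ (eval q r)))

-- Degrees and units

module _ {g : Poly} {n : ℕ} (deg : HasDegree g n) where
  private
    lead≢0 : coeff g n ≢ 0ℚ
    lead≢0 = proj₁ deg
    above : ∀ m → n ℕ.< m → coeff g m ≡ 0ℚ
    above = proj₂ deg

  -- Induction on the list `k`. Since `g` vanishes above degree `n`, the coefficients of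
  -- `(a ∷ k) *ₚ g` from `n + 1` on are those of `k *ₚ g` from `n` on, so the tail is zero by
  -- induction. The coefficient at `n` is then `a` times the leading coefficient of `g`, whence `a`
  -- is zero.
  low-degree-multiple : ∀ k → (∀ m → n ℕ.≤ m → coeff (k *ₚ g) m ≡ 0ℚ) → k ≈ₚ []
  low-degree-multiple []      low = λ _ → refl
  low-degree-multiple (a ∷ k) low = λ { zero → a≡0 ; (suc m) → k≈0 m }
    where
    split : ∀ m → coeff ((a ∷ k) *ₚ g) m ≡ a * coeff g m + coeff (0ℚ ∷ k *ₚ g) m
    split m = trans (coeff-+ (map (a *_) g) (0ℚ ∷ k *ₚ g) m)
                    (cong (_+ coeff (0ℚ ∷ k *ₚ g) m) (coeff-scale a g m))
    k≈0 : k ≈ₚ []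
    k≈0 = low-degree-multiple k λ m n≤m → begin
      coeff (k *ₚ g) m                          ≡⟨ ℚ.+-identityˡ _ ⟨
      0ℚ + coeff (k *ₚ g) m                     ≡⟨ cong (_+ coeff (k *ₚ g) m) (ℚ.*-zeroʳ a) ⟨
      a * 0ℚ + coeff (k *ₚ g) m                 ≡⟨ cong (λ x → a * x + coeff (k *ₚ g) m) (above (suc m) (s≤s n≤m)) ⟨
      a * coeff g (suc m) + coeff (k *ₚ g) m    ≡⟨ split (suc m) ⟨
      coeff ((a ∷ k) *ₚ g) (suc m)              ≡⟨ low (suc m) (ℕ.m≤n⇒m≤1+n n≤m) ⟩
      0ℚ                                        ∎
      where open ≡-Reasoning
    shifted≈0 : ∀ m → coeff (0ℚ ∷ k *ₚ g) m ≡ 0ℚ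
    shifted≈0 zero    = refl
    shifted≈0 (suc m) = *ₚ-zeroˡ {k} g k≈0 m
    a≡0 : a ≡ 0ℚ
    a≡0 = *≡0ʳ lead≢0 (begin
      coeff g n * a                             ≡⟨ ℚ.*-comm (coeff g n) a ⟩
      a * coeff g n                             ≡⟨ ℚ.+-identityʳ _ ⟨
      a * coeff g n + 0ℚ                        ≡⟨ cong (a * coeff g n +_) (shifted≈0 n) ⟨
      a * coeff g n + coeff (0ℚ ∷ k *ₚ g) n     ≡⟨ split n ⟨
      coeff ((a ∷ k) *ₚ g) n                    ≡⟨ low n ℕ.≤-refl ⟩
      0ℚ                                        ∎)
      where open ≡-Reasoning

positive-degree-∤1 : ∀ {g n} → HasDegree g (suc n) → ¬ (g ∣ const 1ℚ)
positive-degree-∤1 {g} deg (k , kg≈1) =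
  contradiction (trans (sym (kg≈1 0)) (*ₚ-zeroˡ {k} g k≈0 0)) λ ()
  where
  k≈0 : k ≈ₚ []
  k≈0 = low-degree-multiple deg k λ { (suc m) _ → kg≈1 (suc m) }

-- Division by linear polynomials

div : ℚ → Poly → Poly
div r []      = []
-- Synthetic division: the coefficients of the quotient by `X- r` are the Horner values at `r` of
-- the successive tails, and the value of the whole list is the remainder.
div r (a ∷ p) = eval p r ∷ div r p

div-zero : ∀ r p → p ≈ₚ [] → div r p ≈ₚ []
div-zero r []      p≈0 n       = refl
div-zero r (a ∷ p) p≈0 zero    = eval-zero p r (p≈0 ∘ suc)
div-zero r (a ∷ p) p≈0 (suc n) = div-zero r p (p≈0 ∘ suc) n

div-degree : ∀ r p n → HasDegree p (suc n) → HasDegree (div r p) n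
div-degree r []          n       (lead≢0 , _)     = contradiction refl lead≢0
div-degree r (a ∷ [])    n       (lead≢0 , _)     = contradiction refl lead≢0
div-degree r (a ∷ b ∷ p) zero    (lead≢0 , above) =
  (λ eval≡0 → lead≢0 (trans (sym eval≡b) eval≡0)) ,
  λ { (suc zero)    _ → eval-zero p r p≈0
    ; (suc (suc m)) _ → div-zero r p p≈0 m }
  where
  p≈0 : p ≈ₚ []
  p≈0 m = above (suc (suc m)) (s≤s (s≤s z≤n))
  eval≡b : b + r * eval p r ≡ b
  eval≡b = trans (cong (λ x → b + r * x) (eval-zero p r p≈0))
                 (trans (cong (b +_) (ℚ.*-zeroʳ r)) (ℚ.+-identityʳ b))
div-degree r (a ∷ b ∷ p) (suc n) (lead≢0 , above)
  with div-degree r (b ∷ p) n (lead≢0 , λ m n<m → above (suc m) (s≤s n<m))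
... | lead′≢0 , above′ = lead′≢0 , λ { (suc m) (s≤s n<m) → above′ m n<m }

X-_ : ℚ → Poly
X- r = - r ∷ 1ℚ ∷ []

coeff-X-*-zero : ∀ r q → coeff ((X- r) *ₚ q) 0 ≡ - r * coeff q 0
coeff-X-*-zero r q = coeff-* (X- r) q 0

coeff-X-*-suc : ∀ r q n → coeff ((X- r) *ₚ q) (suc n) ≡ - r * coeff q (suc n) + coeff q n
coeff-X-*-suc r q n =
  trans (coeff-* (X- r) q (suc n)) (cong (- r * coeff q (suc n) +_) (monic n))
  where
  monic : ∀ n → convolution (coeff (1ℚ ∷ [])) (coeff q) n ≡ coeff q n
  monic zero    = ℚ.*-identityˡ (coeff q 0)
  monic (suc n) =
    trans (cong₂ _+_ (ℚ.*-identityˡ (coeff q (suc n))) (convolution-zeroˡ (coeff q) n))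
          (ℚ.+-identityʳ (coeff q (suc n)))

coeff-div-zero : ∀ r p → coeff p 0 ≡ eval p r + - r * coeff (div r p) 0
coeff-div-zero r []      = sym (trans (ℚ.+-identityˡ _) (ℚ.*-zeroʳ (- r)))
coeff-div-zero r (a ∷ p) = identity a r (eval p r)
  where
  identity : ∀ a r x → a ≡ a + r * x + - r * x
  identity = solve-∀ ℚ-ring

coeff-div-suc : ∀ r p n → coeff p (suc n) ≡ coeff (div r p) n + - r * coeff (div r p) (suc n)
coeff-div-suc r []      n       = sym (trans (ℚ.+-identityˡ _) (ℚ.*-zeroʳ (- r)))
coeff-div-suc r (a ∷ p) zero    = coeff-div-zero r p
coeff-div-suc r (a ∷ p) (suc n) = coeff-div-suc r p n

factor-theorem : ∀ r p → eval p r ≡ 0ℚ → p ≈ₚ (X- r) *ₚ div r p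
factor-theorem r p root zero =
  trans (coeff-div-zero r p)
        (trans (cong (_+ - r * coeff (div r p) 0) root)
               (trans (ℚ.+-identityˡ _) (sym (coeff-X-*-zero r (div r p)))))
factor-theorem r p root (suc n) =
  trans (coeff-div-suc r p n)
        (trans (ℚ.+-comm (coeff (div r p) n) _) (sym (coeff-X-*-suc r (div r p) n)))

eval-X- : ∀ r → - r + r * (1ℚ + r * 0ℚ) ≡ 0ℚ
eval-X- = solve-∀ ℚ-ring

eval-X-* : ∀ r q → eval ((X- r) *ₚ q) r ≡ 0ℚ
eval-X-* r q = trans (eval-* (X- r) q r)
  (trans (cong (_* eval q r) (eval-X- r)) (ℚ.*-zeroˡ (eval q r)))

-- Coefficients are compared from the constant term upwards: once the lower ones agree, the next two
-- agree after multiplication by `- r`, which is cancelled because `r` is nonzero.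
X-*-cancel : ∀ {r} p q → r ≢ 0ℚ → (X- r) *ₚ p ≈ₚ (X- r) *ₚ q → p ≈ₚ q
X-*-cancel {r} p q r≢0 eq = λ
  -- No lower coefficient contributes to the constant term, so the shared summand is `0ℚ`.
  { zero    → cancel (coeff p 0) (coeff q 0) 0ℚ
      (cong (_+ 0ℚ) (trans (sym (coeff-X-*-zero r p)) (trans (eq 0) (coeff-X-*-zero r q))))
  ; (suc n) → cancel (coeff p (suc n)) (coeff q (suc n)) (coeff p n)
      (trans (sym (coeff-X-*-suc r p n)) (trans (eq (suc n)) (trans (coeff-X-*-suc r q n)
        (cong (- r * coeff q (suc n) +_) (sym (X-*-cancel p q r≢0 eq n)))))) }
  where
  identity : ∀ r x y z → r * (x - y) ≡ (- r * y + z) - (- r * x + z)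
  identity = solve-∀ ℚ-ring
  cancel : ∀ x y z → - r * x + z ≡ - r * y + z → x ≡ y
  cancel x y z e = x∙y⁻¹≈ε⇒x≈y x y (*≡0ʳ r≢0 (trans (identity r x y z)
    (trans (cong (- r * y + z +_) (cong -_ e)) (ℚ.+-inverseʳ (- r * y + z)))))

-- Replaces an unknown cofactor by the explicit quotient, whose values the ring solver can compute.
div-unique : ∀ p r q → r ≢ 0ℚ → p ≈ₚ (X- r) *ₚ q → q ≈ₚ div r p
div-unique p r q r≢0 p≈ = X-*-cancel q (div r p) r≢0 λ n → trans (sym (p≈ n))
  (factor-theorem r p (trans (eval-cong p ((X- r) *ₚ q) r p≈) (eval-X-* r q)) n)

X--degree : ∀ r → HasDegree (X- r) 1
X--degree r = (λ ()) , λ { (suc zero) (s≤s ()) ; (suc (suc m)) _ → refl }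

-- A root splits off `X- r` and leaves a quotient of degree at least one; neither factor is a unit.
irreducible-rootless : ∀ {p n} → Irreducible p → HasDegree p (suc (suc n)) → ∀ r → eval p r ≢ 0ℚ
irreducible-rootless {p} {n} (mkIrred _ split) deg r root with split {X- r} {div r p} (factor-theorem r p root)
... | inj₁ unit = positive-degree-∤1 (X--degree r) unit
... | inj₂ unit = positive-degree-∤1 (div-degree r p (suc n) deg) unit

linear-factor : ∀ {p} → HasDegree p 1 → ∃[ k ] ∃[ r ] k ≢ 0ℚ × p ≈ₚ map (k *_) (X- r)
linear-factor {p} (lead≢0 , above) with invert lead≢0
... | i , ki≡1 = k , - (c * i) , lead≢0 , λ
  { zero → trans (sym (trans (cong (c *_) ki≡1) (ℚ.*-identityʳ c))) (identity k c i)
  ; (suc zero) → sym (ℚ.*-identityʳ k)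
  ; (suc (suc m)) → above (suc (suc m)) (s≤s (s≤s z≤n)) }
  where
  k = coeff p 1
  c = coeff p 0
  identity : ∀ k c i → c * (k * i) ≡ k * - - (c * i)
  identity = solve-∀ ℚ-ring

monic-quadratic : ∀ {p} → HasDegree p 2 → ∃[ k ] ∃[ a ] ∃[ b ] p ≈ₚ map (k *_) (b ∷ a ∷ 1ℚ ∷ [])
monic-quadratic {p} (lead≢0 , above) with invert lead≢0
... | i , ki≡1 = k , coeff p 1 * i , coeff p 0 * i , λ
  { zero → normalised (coeff p 0)
  ; (suc zero) → normalised (coeff p 1)
  ; (suc (suc zero)) → sym (ℚ.*-identityʳ k)
  ; (suc (suc (suc m))) → above (suc (suc (suc m))) (s≤s (s≤s (s≤s z≤n))) }
  where
  k = coeff p 2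
  identity : ∀ k c i → c * (k * i) ≡ k * (c * i)
  identity = solve-∀ ℚ-ring
  normalised : ∀ c → c ≡ k * (c * i)
  normalised c = trans (sym (trans (cong (c *_) ki≡1) (ℚ.*-identityʳ c))) (identity k c i)

-- Symbolic polynomials

open import Tactic.RingSolver.NonReflective ℚ-ring using (Expr; Κ; Ι; _⊕_; _⊗_; ⊝_; solve; module Ops)
open Ops using (⟦_⟧; ⟦_⇓⟧; correct)

-- Polynomials whose coefficients are ring solver expressions. The operations copy
-- those on Poly, so on lists of known length they commute with ⟦_⟧ definitionally.
infixl 6 _⊞_
infixl 7 _⊠_

_⊞_ : ∀ {n} → List (Expr ℚ n) → List (Expr ℚ n) → List (Expr ℚ n)
[]      ⊞ q       = q
(a ∷ p) ⊞ []      = a ∷ p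
(a ∷ p) ⊞ (b ∷ q) = a ⊕ b ∷ p ⊞ q

_⊠_ : ∀ {n} → List (Expr ℚ n) → List (Expr ℚ n) → List (Expr ℚ n)
[]      ⊠ q = []
(a ∷ p) ⊠ q = map (a ⊗_) q ⊞ (Κ 0ℚ ∷ p ⊠ q)

_·𝕏^_ : ∀ {n} → Expr ℚ n → ℕ → List (Expr ℚ n)
a ·𝕏^ k = replicate k (Κ 0ℚ) ++ (a ∷ [])

-- Soundness of the ring solver, applied to all coefficients at once. The hypothesis compares normal
-- forms and is discharged by `refl` at each use.
solveₚ : ∀ {n} (p q : List (Expr ℚ n)) (ρ : Vec ℚ n) →
         map (λ e → ⟦ e ⇓⟧ ρ) p ≡ map (λ e → ⟦ e ⇓⟧ ρ) q →
         map (λ e → ⟦ e ⟧ ρ) p ≡ map (λ e → ⟦ e ⟧ ρ) q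
solveₚ p q ρ eq =
  trans (sym (map-cong (λ e → correct e ρ) p)) (trans eq (map-cong (λ e → correct e ρ) q))

trinomialᴱ : ∀ {n} → Expr ℚ n → Expr ℚ n → List (Expr ℚ n)
trinomialᴱ A B = Κ 1ℚ ·𝕏^ 6 ⊞ A ·𝕏^ 3 ⊞ B ·𝕏^ 0

-- Sums such as `0ℚ + A` in the trinomial do not compute for a variable `A`, so the plain list of
-- coefficients has to be reached by the solver.
trinomial-coefficients : ∀ A B → trinomial 6 3 A B ≡ B ∷ 0ℚ ∷ 0ℚ ∷ A ∷ 0ℚ ∷ 0ℚ ∷ 1ℚ ∷ []
trinomial-coefficients A B = solveₚ (trinomialᴱ (Ι 0F) (Ι 1F))
  (Ι 1F ∷ Κ 0ℚ ∷ Κ 0ℚ ∷ Ι 0F ∷ Κ 0ℚ ∷ Κ 0ℚ ∷ Κ 1ℚ ∷ []) (A Vec.∷ B Vec.∷ Vec.[]) refl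

evalᴱ : ∀ {n} → List (Expr ℚ n) → Expr ℚ n → Expr ℚ n
evalᴱ []      r = Κ 0ℚ
evalᴱ (a ∷ p) r = a ⊕ r ⊗ evalᴱ p r

divᴱ : ∀ {n} → Expr ℚ n → List (Expr ℚ n) → List (Expr ℚ n)
divᴱ r []      = []
divᴱ r (a ∷ p) = evalᴱ p r ∷ divᴱ r p

-- Rational roots of the trinomial

cube : ℚ → ℚ
cube x = x * (x * x)

cubeᴱ : ∀ {n} → Expr ℚ n → Expr ℚ n
cubeᴱ x = x ⊗ (x ⊗ x)

eval-trinomial : ∀ A B r → eval (trinomial 6 3 A B) r ≡ B + cube r * (A + cube r)
eval-trinomial = solve 3 (λ A B r → evalᴱ (trinomialᴱ A B) r , B ⊕ cubeᴱ r ⊗ (A ⊕ cubeᴱ r)) refl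

-- The divided difference of `T = x⁶ + A x³ + B`: `T(s) - T(r) = (s³ - r³)(A + r³ + s³)`, divided by
-- `s - r`. As an identity in all variables it also covers the double root `s = r`.
eval-div-trinomial : ∀ A B r s →
  eval (div r (trinomial 6 3 A B)) s ≡ (r * r + r * s + s * s) * (A + (cube r + cube s))
eval-div-trinomial = solve 4 (λ A B r s → evalᴱ (divᴱ r (trinomialᴱ A B)) s
  , (r ⊗ r ⊕ r ⊗ s ⊕ s ⊗ s) ⊗ (A ⊕ (cubeᴱ r ⊕ cubeᴱ s))) refl

-- The second divided difference. Write the first one at `t` as `(r² + r t + t²)((A + r³ + s³) + (t³
-- - s³))`, subtract its value at `s` and divide by `t - s`. The last term drops out once `A + r³ +
-- s³ = 0`.
eval-div-div-trinomial : ∀ A B r s t →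
  eval (div s (div r (trinomial 6 3 A B))) t
    ≡ (r * r + r * t + t * t) * (s * s + s * t + t * t) + (r + s + t) * (A + (cube r + cube s))
eval-div-div-trinomial = solve 5 (λ A B r s t → evalᴱ (divᴱ s (divᴱ r (trinomialᴱ A B))) t
  , (r ⊗ r ⊕ r ⊗ t ⊕ t ⊗ t) ⊗ (s ⊗ s ⊕ s ⊗ t ⊕ t ⊗ t) ⊕ (r ⊕ s ⊕ t) ⊗ (A ⊕ (cubeᴱ r ⊕ cubeᴱ s))) refl

-- The leading coefficient of `f` is moved into the cofactor, which makes the linear factor exactly
-- `X- r`.
linear-cofactor : ∀ p f g → HasDegree f 1 → p ≈ₚ f *ₚ g →
  ∃[ r ] ∃[ k ] k ≢ 0ℚ × eval f r ≡ 0ℚ × p ≈ₚ (X- r) *ₚ map (k *_) g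
linear-cofactor p f g deg p≈ with linear-factor {f} deg
... | k , r , k≢0 , f≈ = r , k , k≢0 ,
  trans (eval-cong f (map (k *_) (X- r)) r f≈) (eval-scale-root k (X- r) r (eval-X- r)) ,
  λ n → trans (p≈ n)
    (trans (*ₚ-cong {f} {map (k *_) (X- r)} {g} {g} f≈ (λ _ → refl) n)
      (trans (*ₚ-scaleˡ k (X- r) g n) (sym (*ₚ-scaleʳ k (X- r) g n))))

root-≢0 : ∀ {A B r} → B ≢ 0ℚ → B + cube r * (A + cube r) ≡ 0ℚ → r ≢ 0ℚ
root-≢0 {A} {B} B≢0 root refl = B≢0 (trans (sym (identity A B)) root)
  where
  identity : ∀ A B → B + 0ℚ * (0ℚ * 0ℚ) * (A + 0ℚ * (0ℚ * 0ℚ)) ≡ B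
  identity = solve-∀ ℚ-ring

module _ (A : ℚ) {B : ℚ} (B≢0 : B ≢ 0ℚ) where
  private
    T : Poly
    T = trinomial 6 3 A B

  trinomial-root : ∀ r q → T ≈ₚ (X- r) *ₚ q → r ≢ 0ℚ × B + cube r * (A + cube r) ≡ 0ℚ
  trinomial-root r q T≈ = root-≢0 {A} {B} {r} B≢0 root , root
    where
    root : B + cube r * (A + cube r) ≡ 0ℚ
    root = trans (sym (eval-trinomial A B r))
             (trans (eval-cong T ((X- r) *ₚ q) r T≈) (eval-X-* r q))

  eval-cofactor : ∀ r q s → T ≈ₚ (X- r) *ₚ q →
                  eval q s ≡ (r * r + r * s + s * s) * (A + (cube r + cube s))
  eval-cofactor r q s T≈ =
    trans (eval-cong q (div r T) s (div-unique T r q (proj₁ (trinomial-root r q T≈)) T≈))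
          (eval-div-trinomial A B r s)

  two-roots : ∀ r q s → T ≈ₚ (X- r) *ₚ q → eval q s ≡ 0ℚ → A + (cube r + cube s) ≡ 0ℚ
  two-roots r q s T≈ root =
    *≡0ʳ (norm-≢0 s (proj₁ (trinomial-root r q T≈))) (trans (sym (eval-cofactor r q s T≈)) root)

  -- Two roots force `A + r³ + s³ = 0`, and then the remaining cofactor takes at `t` the value
  -- `(r² + r t + t²)(s² + s t + t²)`, a product of nonzero norms. Repeated roots are included.
  no-third-root : ∀ r s q t → s ≢ 0ℚ → T ≈ₚ (X- r) *ₚ ((X- s) *ₚ q) → eval q t ≢ 0ℚ
  no-third-root r s q t s≢0 T≈ root = *-≢0 (norm-≢0 t r≢0) (norm-≢0 t s≢0) (begin
    N                                              ≡⟨ ℚ.+-identityʳ N ⟨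
    N + 0ℚ                                         ≡⟨ cong (λ x → N + x) (ℚ.*-zeroʳ (r + s + t)) ⟨
    N + (r + s + t) * 0ℚ                           ≡⟨ cong (λ x → N + (r + s + t) * x) A+r³+s³≡0 ⟨
    N + (r + s + t) * (A + (cube r + cube s))      ≡⟨ eval-div-div-trinomial A B r s t ⟨
    eval (div s (div r T)) t                       ≡⟨ eval-cong q (div s (div r T)) t q≈ ⟨
    eval q t                                       ≡⟨ root ⟩
    0ℚ                                             ∎)
    where
    open ≡-Reasoning
    N = (r * r + r * t + t * t) * (s * s + s * t + t * t)
    r≢0 = proj₁ (trinomial-root r ((X- s) *ₚ q) T≈)
    A+r³+s³≡0 = two-roots r ((X- s) *ₚ q) s T≈ (eval-X-* s q)
    q≈ : q ≈ₚ div s (div r T)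
    q≈ = div-unique (div r T) s q s≢0 (λ n → sym (div-unique T r ((X- s) *ₚ q) r≢0 T≈ n))

-- The root `r` is the scaling factor and `u = s / r`. The hypotheses amount to `A = -(r³ + s³)` and
-- `B = r³ s³`, so `u = 0` would give `B = 0`, and `u = -1` would give `A = 0`.
scaled-pair : ∀ {A B r s} → A ≢ 0ℚ → B ≢ 0ℚ → r ≢ 0ℚ →
  A + (cube r + cube s) ≡ 0ℚ → B + cube r * (A + cube r) ≡ 0ℚ →
  ∃[ u ] u ≢ 0ℚ × u ≢ - 1ℚ × EqualUpToScaling 6 3 A B (- (u ^ 3) - 1ℚ) (u ^ 3)
scaled-pair {A} {B} {r} {s} A≢0 B≢0 r≢0 A+r³+s³≡0 root =
  u , u≢0 , u≢-1 , r , r≢0 , A≡ , B≡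
  where
  i : ℚ
  i = proj₁ (invert r≢0)
  ri≡1 : r * i ≡ 1ℚ
  ri≡1 = proj₂ (invert r≢0)
  u : ℚ
  u = s * i
  s≡ur : s ≡ u * r
  s≡ur = trans (sym (trans (cong (s *_) ri≡1) (ℚ.*-identityʳ s))) (identity s r i)
    where
    identity : ∀ s r i → s * (r * i) ≡ s * i * r
    identity = solve-∀ ℚ-ring
  A≡ : A ≡ (- (u ^ 3) - 1ℚ) * r ^ 3
  A≡ = trans (inverseˡ-unique A (cube r + cube s) A+r³+s³≡0)
             (trans (cong (λ x → - (cube r + cube x)) s≡ur) (identity u r))
    where
    -- Powers are written as `_^_` unfolds them, with a final factor `1ℚ`, so the identity matches
    -- `u ^ 3` and `r ^ 3` definitionally.
    identity : ∀ u r → - (r * (r * r) + u * r * (u * r * (u * r)))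
                       ≡ (- (u * (u * (u * 1ℚ))) - 1ℚ) * (r * (r * (r * 1ℚ)))
    identity = solve-∀ ℚ-ring
  B≡ : B ≡ u ^ 3 * r ^ 6
  B≡ = trans (inverseˡ-unique B (cube r * (A + cube r)) root)
             (trans (cong (λ x → - (cube r * (x + cube r))) A≡) (identity u r))
    where
    identity : ∀ u r → - (r * (r * r) * ((- (u * (u * (u * 1ℚ))) - 1ℚ) * (r * (r * (r * 1ℚ))) + r * (r * r)))
                       ≡ u * (u * (u * 1ℚ)) * (r * (r * (r * (r * (r * (r * 1ℚ))))))
    identity = solve-∀ ℚ-ring
  u≢0 : u ≢ 0ℚ
  u≢0 u≡0 = B≢0 (trans B≡ (trans (cong (λ x → x ^ 3 * r ^ 6) u≡0) (ℚ.*-zeroˡ (r ^ 6))))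
  u≢-1 : u ≢ - 1ℚ
  u≢-1 u≡-1 = A≢0 (trans A≡ (trans (cong (λ x → (- (x ^ 3) - 1ℚ) * r ^ 3) u≡-1) (ℚ.*-zeroˡ (r ^ 3))))

-- Reducibility types with a linear factor

type-1122 : ∀ {A B} → A ≢ 0ℚ → B ≢ 0ℚ → HasReducibilityType (trinomial 6 3 A B) (1 ∷ 1 ∷ 2 ∷ 2 ∷ []) →
  ∃[ u ] u ≢ 0ℚ × u ≢ - 1ℚ × EqualUpToScaling 6 3 A B (- (u ^ 3) - 1ℚ) (u ^ 3)
type-1122 {A} {B} A≢0 B≢0 record
  { factors = f ∷ g ∷ rest
  ; irreducible = (_ , deg-f) ∷ (_ , deg-g) ∷ _
  ; factorizes = T≈fg… } =
  let q = g *ₚ productₚ rest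
      r , k , _ , _ , T≈ = linear-cofactor (trinomial 6 3 A B) f q deg-f T≈fg…
      -- The trivial factorization of `q` supplies a root of `g`.
      s , _ , _ , root , _ = linear-cofactor q g (productₚ rest) deg-g (λ _ → refl)
      r≢0 , r-root = trinomial-root A B≢0 r (map (k *_) q) T≈
  in scaled-pair {A} {B} {r} {s} A≢0 B≢0 r≢0
       (two-roots A B≢0 r (map (k *_) q) s T≈
         (eval-scale-root k q s (eval-*-rootˡ g (productₚ rest) s root)))
       r-root

type-11112 : ∀ {A B} → B ≢ 0ℚ → ¬ HasReducibilityType (trinomial 6 3 A B) (1 ∷ 1 ∷ 1 ∷ 1 ∷ 2 ∷ [])
type-11112 {A} {B} B≢0 record
  { factors = f ∷ g ∷ h ∷ rest
  ; irreducible = (_ , deg-f) ∷ (_ , deg-g) ∷ (_ , deg-h) ∷ _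
  ; factorizes = T≈fgh… } =
  let ph = h *ₚ productₚ rest
      q = g *ₚ ph
      r , k , _ , _ , T≈ = linear-cofactor (trinomial 6 3 A B) f q deg-f T≈fgh…
      s , l , _ , g-root , q≈ = linear-cofactor q g ph deg-g (λ _ → refl)
      t , _ , _ , h-root , _ = linear-cofactor ph h (productₚ rest) deg-h (λ _ → refl)
      -- Both leading constants are collected in the last cofactor, so that `T = (X- r)(X- s) c`.
      c = map (k *_) (map (l *_) ph)
      kq≈ : map (k *_) q ≈ₚ (X- s) *ₚ c
      kq≈ = λ n → trans (scale-cong k {q} {(X- s) *ₚ map (l *_) ph} q≈ n)
                        (sym (*ₚ-scaleʳ k (X- s) (map (l *_) ph) n))
      T≈rs : trinomial 6 3 A B ≈ₚ (X- r) *ₚ ((X- s) *ₚ c)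
      T≈rs = λ n → trans (T≈ n) (*ₚ-cong {X- r} {X- r} {map (k *_) q} {(X- s) *ₚ c} (λ _ → refl) kq≈ n)
  in no-third-root A B≢0 r s c t
       (second-root-≢0 r s (map (k *_) q) T≈
         (eval-scale-root k q s (eval-*-rootˡ g ph s g-root)))
       T≈rs
       (eval-scale-root k (map (l *_) ph) t (eval-scale-root l ph t (eval-*-rootˡ h (productₚ rest) t h-root)))
  where
  second-root-≢0 : ∀ r s q → trinomial 6 3 A B ≈ₚ (X- r) *ₚ q → eval q s ≡ 0ℚ → s ≢ 0ℚ
  second-root-≢0 r s q T≈ q-root = root-≢0 {A} {B} {s} B≢0 s-root
    where
    s-root : B + cube s * (A + cube s) ≡ 0ℚ
    s-root = trans (sym (eval-trinomial A B s))
      (trans (eval-cong (trinomial 6 3 A B) ((X- r) *ₚ q) s T≈)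
        (trans (eval-* (X- r) q s) (trans (cong (eval (X- r) s *_) q-root) (ℚ.*-zeroʳ (eval (X- r) s)))))

type-123 : ∀ {A B} → B ≢ 0ℚ → HasReducibilityType (trinomial 6 3 A B) (1 ∷ 2 ∷ 3 ∷ []) →
  ∃[ t ] ¬ (∃[ v ] t ≡ v ^ 3) × EqualUpToScaling 6 3 A B (t - 1ℚ) (- t)
type-123 {A} {B} B≢0 record
  { factors = f ∷ g ∷ h ∷ []
  ; irreducible = (_ , deg-f) ∷ (irr-g , deg-g) ∷ (irr-h , deg-h) ∷ []
  ; factorizes = T≈fgh } =
  let q = g *ₚ (h *ₚ const 1ℚ)
      r , k , k≢0 , _ , T≈ = linear-cofactor (trinomial 6 3 A B) f q deg-f T≈fgh
      r≢0 , root = trinomial-root A B≢0 r (map (k *_) q) T≈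
      i , ri≡1 = invert r≢0
      -- The solution of `A = (t - 1) r³`, with `i = 1 / r`.
      t = A * cube i + 1ℚ
      A≡ = A-scaled r i ri≡1
  in t , (λ { (v , t≡v³) → no-cube-root r k k≢0 T≈ v (A≡-cubes r t v A≡ t≡v³) })
     , r , r≢0 , A≡ , B-scaled r t A≡ root
  where
  A-scaled : ∀ r i → r * i ≡ 1ℚ → A ≡ (A * cube i + 1ℚ - 1ℚ) * r ^ 3
  A-scaled r i ri≡1 = sym (trans (identity A r i) (trans (cong (λ x → A * cube x) ri≡1) (ℚ.*-identityʳ A)))
    where
    identity : ∀ A r i → (A * (i * (i * i)) + 1ℚ - 1ℚ) * (r * (r * (r * 1ℚ)))
                         ≡ A * (r * i * (r * i * (r * i)))
    identity = solve-∀ ℚ-ring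
  B-scaled : ∀ r t → A ≡ (t - 1ℚ) * r ^ 3 → B + cube r * (A + cube r) ≡ 0ℚ → B ≡ - t * r ^ 6
  B-scaled r t A≡ root = trans (inverseˡ-unique B (cube r * (A + cube r)) root)
      (trans (cong (λ x → - (cube r * (x + cube r))) A≡) (identity t r))
    where
    identity : ∀ t r → - (r * (r * r) * ((t - 1ℚ) * (r * (r * (r * 1ℚ))) + r * (r * r)))
                       ≡ - t * (r * (r * (r * (r * (r * (r * 1ℚ))))))
    identity = solve-∀ ℚ-ring
  A≡-cubes : ∀ r t v → A ≡ (t - 1ℚ) * r ^ 3 → t ≡ v ^ 3 → A + (cube r + cube (- v * r)) ≡ 0ℚ
  A≡-cubes r t v A≡ t≡v³ = trans
    (cong (_+ (cube r + cube (- v * r))) (trans A≡ (cong (λ x → (x - 1ℚ) * r ^ 3) t≡v³)))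
    (identity r v)
    where
    identity : ∀ r v → (v * (v * (v * 1ℚ)) - 1ℚ) * (r * (r * (r * 1ℚ)))
                       + (r * (r * r) + - v * r * (- v * r * (- v * r))) ≡ 0ℚ
    identity = solve-∀ ℚ-ring
  no-cube-root : ∀ r k → k ≢ 0ℚ → trinomial 6 3 A B ≈ₚ (X- r) *ₚ map (k *_) (g *ₚ (h *ₚ const 1ℚ)) →
                 ∀ v → A + (cube r + cube (- v * r)) ≢ 0ℚ
  no-cube-root r k k≢0 T≈ v A+≡0 =
    -- At `s` the cofactor is a product of nonzero values, since `g` and `h` are irreducible of
    -- degrees 2 and 3; `eval-cofactor` says that it vanishes there.
    *-≢0 k≢0 (*-≢0 (irreducible-rootless {g} irr-g deg-g s)
      (*-≢0 (irreducible-rootless {h} irr-h deg-h s) (eval-const-1≢0))) (begin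
      k * (eval g s * (eval h s * eval (const 1ℚ) s)) ≡⟨ cong (λ x → k * (eval g s * x)) (eval-* h (const 1ℚ) s) ⟨
      k * (eval g s * eval (h *ₚ const 1ℚ) s)         ≡⟨ cong (k *_) (eval-* g (h *ₚ const 1ℚ) s) ⟨
      k * eval (g *ₚ (h *ₚ const 1ℚ)) s               ≡⟨ eval-scale k (g *ₚ (h *ₚ const 1ℚ)) s ⟨
      eval (map (k *_) (g *ₚ (h *ₚ const 1ℚ))) s      ≡⟨ eval-cofactor A B≢0 r (map (k *_) (g *ₚ (h *ₚ const 1ℚ))) s T≈ ⟩
      (r * r + r * s + s * s) * (A + (cube r + cube s)) ≡⟨ cong ((r * r + r * s + s * s) *_) A+≡0 ⟩
      (r * r + r * s + s * s) * 0ℚ                    ≡⟨ ℚ.*-zeroʳ (r * r + r * s + s * s) ⟩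
      0ℚ                                              ∎)
    where
    open ≡-Reasoning
    s = - v * r
    eval-const-1≢0 : eval (const 1ℚ) s ≢ 0ℚ
    eval-const-1≢0 e = contradiction (trans (sym (cong (1ℚ +_) (ℚ.*-zeroʳ s))) e) λ ()

-- Products of three quadratics

-- The coefficients of x, x² and x⁴ in (x² + a x + b)(x² + c x + d)(x² + e x + f).
coeff₁ coeff₂ coeff₄ : (a b c d e f : ℚ) → ℚ
coeff₁ a b c d e f = a * d * f + b * c * f + e * (b * d)
coeff₂ a b c d e f = b * d + b * f + d * f + a * c * f + e * (a * d + b * c)
coeff₄ a b c d e f = b + d + f + (a * c + e * (a + c))

-- The identities below come from writing b = f - X and d = f - Y. With s = a + c = -e,
-- the coefficients of x and x² become equations linear in 1/X and 1/Y, whose determinant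
-- is f (c - a) (f - s²).
equal-pair : ∀ {a c d f} → f ≢ 0ℚ → f ≢ d →
  coeff₁ a f c d (- (a + c)) f ≡ 0ℚ → coeff₂ a f c d (- (a + c)) f ≡ 0ℚ → coeff₄ a f c d (- (a + c)) f ≡ 0ℚ → d + a * (a + c) ≡ 0ℚ
equal-pair {a} {c} {d} {f} f≢0 f≢d c₁ c₂ c₄ =
  -- With `b = f` the first equation reads `f (f - d) c = 0`, so `c = 0`. Then
  -- `coeff₂ - d coeff₄ = (f - d)(f + d)` gives `d = -f`, and `coeff₄` gives `f = a²`.
  at-c≡0 c (*≡0ʳ (x-y≢0 f≢d) (*≡0ʳ f≢0 (trans (identity₁ a c d f) c₁))) c₂ c₄
  where
  identity₁ : ∀ a c d f → f * ((f - d) * c) ≡ a * d * f + f * c * f + - (a + c) * (f * d)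
  identity₁ = solve-∀ ℚ-ring
  identity₂ : ∀ a d f → (f - d) * (f + d)
    ≡ 1ℚ * (f * d + f * f + d * f + a * 0ℚ * f + - (a + 0ℚ) * (a * d + f * 0ℚ))
      + - d * (f + d + f + (a * 0ℚ + - (a + 0ℚ) * (a + 0ℚ)))
  identity₂ = solve-∀ ℚ-ring
  identity₃ : ∀ a d f → d + a * (a + 0ℚ)
    ≡ (1ℚ + 1ℚ) * (f + d) + - 1ℚ * (f + d + f + (a * 0ℚ + - (a + 0ℚ) * (a + 0ℚ)))
  identity₃ = solve-∀ ℚ-ring
  at-c≡0 : ∀ c → c ≡ 0ℚ → coeff₂ a f c d (- (a + c)) f ≡ 0ℚ → coeff₄ a f c d (- (a + c)) f ≡ 0ℚ → d + a * (a + c) ≡ 0ℚ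
  at-c≡0 c refl c₂ c₄ = combine₂ (1ℚ + 1ℚ) (- 1ℚ) (identity₃ a d f)
    (*≡0ʳ (x-y≢0 f≢d) (combine₂ 1ℚ (- d) (identity₂ a d f) c₂ c₄)) c₄

-- Here the determinant vanishes, but with `s = a + c` the combination `s³ coeff₄ - coeff₁` factors
-- as `s (b + c s)(d + a s)`, and `s` is nonzero because `f = s²` is.
square-case : ∀ {a b c d f} → f ≢ 0ℚ → f ≡ (a + c) * (a + c) →
  coeff₁ a b c d (- (a + c)) f ≡ 0ℚ → coeff₄ a b c d (- (a + c)) f ≡ 0ℚ →
  b + c * (a + c) ≡ 0ℚ ⊎ d + a * (a + c) ≡ 0ℚ
square-case {a} {b} {c} {d} f≢0 refl c₁ c₄ = *≡0 (b + c * (a + c)) (*≡0ʳ s≢0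
  (combine₂ (- 1ℚ) ((a + c) * ((a + c) * (a + c))) (identity a b c d) c₁ c₄))
  where
  s≢0 : a + c ≢ 0ℚ
  s≢0 s≡0 = f≢0 (trans (cong ((a + c) *_) s≡0) (ℚ.*-zeroʳ (a + c)))
  identity : ∀ a b c d → (a + c) * ((b + c * (a + c)) * (d + a * (a + c)))
    ≡ - 1ℚ * (a * d * ((a + c) * (a + c)) + b * c * ((a + c) * (a + c)) + - (a + c) * (b * d))
      + (a + c) * ((a + c) * (a + c)) * (b + d + (a + c) * (a + c) + (a * c + - (a + c) * (a + c)))
  identity = solve-∀ ℚ-ring

-- Cramer's rule gives `c X = f (c - a)` and `a Y = - f (c - a)`, in a form that never divides by
-- `a`, `c` or `c - a`. Substituting both into `a c coeff₄` leaves `(a² + a c + c²)(f - a c) = 0`.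
generic-case : ∀ {a b c d f} → f ≢ b → f ≢ d → f ≢ (a + c) * (a + c) → a * a + a * c + c * c ≢ 0ℚ →
  coeff₁ a b c d (- (a + c)) f ≡ 0ℚ → coeff₂ a b c d (- (a + c)) f ≡ 0ℚ → coeff₄ a b c d (- (a + c)) f ≡ 0ℚ → f ≡ a * c
generic-case {a} {b} {c} {d} {f} f≢b f≢d f≢s² Q≢0 c₁ c₂ c₄ =
  x∙y⁻¹≈ε⇒x≈y f (a * c) (*≡0ʳ Q≢0 (combine₃ (- a) c (a * c) (identity₃ a b c d f)
    (*≡0ʳ (x-y≢0 f≢s²) (*≡0ʳ (x-y≢0 f≢d)
      (combine₃ (f - c * (a + c)) (f * a) (- (f * f * a)) (identity₁ a b c d f) c₁ c₂ c₄)))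
    (*≡0ʳ (x-y≢0 f≢s²) (*≡0ʳ (x-y≢0 f≢b)
      (combine₃ (- (f - a * (a + c))) (- (f * c)) (f * f * c) (identity₂ a b c d f) c₁ c₂ c₄)))
    c₄))
  where
  identity₁ : ∀ a b c d f → (f - d) * ((f - (a + c) * (a + c)) * (f * (c - a) - c * (f - b)))
    ≡ (f - c * (a + c)) * (a * d * f + b * c * f + - (a + c) * (b * d))
      + f * a * (b * d + b * f + d * f + a * c * f + - (a + c) * (a * d + b * c))
      + - (f * f * a) * (b + d + f + (a * c + - (a + c) * (a + c)))
  identity₁ = solve-∀ ℚ-ring
  identity₂ : ∀ a b c d f → (f - b) * ((f - (a + c) * (a + c)) * (f * (c - a) + a * (f - d)))
    ≡ - (f - a * (a + c)) * (a * d * f + b * c * f + - (a + c) * (b * d))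
      + - (f * c) * (b * d + b * f + d * f + a * c * f + - (a + c) * (a * d + b * c))
      + f * f * c * (b + d + f + (a * c + - (a + c) * (a + c)))
  identity₂ = solve-∀ ℚ-ring
  identity₃ : ∀ a b c d f → (a * a + a * c + c * c) * (f - a * c)
    ≡ - a * (f * (c - a) - c * (f - b)) + c * (f * (c - a) + a * (f - d))
      + a * c * (b + d + f + (a * c + - (a + c) * (a + c)))
  identity₃ = solve-∀ ℚ-ring

quadratic-factors : ∀ a b c d f → f ≢ 0ℚ → a * a + a * c + c * c ≢ 0ℚ →
  coeff₁ a b c d (- (a + c)) f ≡ 0ℚ → coeff₂ a b c d (- (a + c)) f ≡ 0ℚ → coeff₄ a b c d (- (a + c)) f ≡ 0ℚ →
  (f ≡ b × f ≡ d) ⊎ b + c * (a + c) ≡ 0ℚ ⊎ d + a * (a + c) ≡ 0ℚ ⊎ f ≡ a * c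
quadratic-factors a b c d f f≢0 Q≢0 c₁ c₂ c₄ with f ≟ b | f ≟ d
... | yes f≡b  | yes f≡d = inj₁ (f≡b , f≡d)
... | yes refl | no f≢d  = inj₂ (inj₂ (inj₁ (equal-pair {a} {c} f≢0 f≢d c₁ c₂ c₄)))
-- The previous case with the first two quadratics exchanged: `a` with `c` and `b` with `d`.
... | no f≢b   | yes refl = inj₂ (inj₁ (trans (cong (λ x → b + c * x) (ℚ.+-comm a c))
    (equal-pair {c} {a} f≢0 f≢b (trans (swap₁ a b c f) c₁) (trans (swap₂ a b c f) c₂) (trans (swap₄ a b c f) c₄))))
  where
  swap₁ : ∀ a b c f → c * b * f + f * a * f + - (c + a) * (f * b) ≡ a * f * f + b * c * f + - (a + c) * (b * f)
  swap₁ = solve-∀ ℚ-ring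
  swap₂ : ∀ a b c f → f * b + f * f + b * f + c * a * f + - (c + a) * (c * b + f * a)
          ≡ b * f + b * f + f * f + a * c * f + - (a + c) * (a * f + b * c)
  swap₂ = solve-∀ ℚ-ring
  swap₄ : ∀ a b c f → f + b + f + (c * a + - (c + a) * (c + a)) ≡ b + f + f + (a * c + - (a + c) * (a + c))
  swap₄ = solve-∀ ℚ-ring
... | no f≢b   | no f≢d with f ≟ (a + c) * (a + c)
...   | yes f≡s² = [ (λ x → inj₂ (inj₁ x)) , (λ x → inj₂ (inj₂ (inj₁ x))) ]′
                     (square-case {a} {b} {c} {d} f≢0 f≡s² c₁ c₄)
...   | no f≢s²  = inj₂ (inj₂ (inj₂ (generic-case {a} {b} {c} {d} f≢b f≢d f≢s² Q≢0 c₁ c₂ c₄)))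

product-of-quadratics : ∀ a b c d e f →
  productₚ ((b ∷ a ∷ 1ℚ ∷ []) ∷ (d ∷ c ∷ 1ℚ ∷ []) ∷ (f ∷ e ∷ 1ℚ ∷ []) ∷ [])
    ≡ b * d * f ∷ coeff₁ a b c d e f ∷ coeff₂ a b c d e f
      ∷ a * (d + f) + c * (b + f) + e * (a * c + (b + d))
      ∷ coeff₄ a b c d e f ∷ e + (a + c) ∷ 1ℚ ∷ []
product-of-quadratics a b c d e f = solveₚ
  ((B ∷ A ∷ Κ 1ℚ ∷ []) ⊠ ((D ∷ C ∷ Κ 1ℚ ∷ []) ⊠ ((F ∷ E ∷ Κ 1ℚ ∷ []) ⊠ (Κ 1ℚ ∷ []))))
  (B ⊗ D ⊗ F ∷ A ⊗ D ⊗ F ⊕ B ⊗ C ⊗ F ⊕ E ⊗ (B ⊗ D)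
    ∷ B ⊗ D ⊕ B ⊗ F ⊕ D ⊗ F ⊕ A ⊗ C ⊗ F ⊕ E ⊗ (A ⊗ D ⊕ B ⊗ C)
    ∷ A ⊗ (D ⊕ F) ⊕ C ⊗ (B ⊕ F) ⊕ E ⊗ (A ⊗ C ⊕ (B ⊕ D))
    ∷ B ⊕ D ⊕ F ⊕ (A ⊗ C ⊕ E ⊗ (A ⊕ C)) ∷ E ⊕ (A ⊕ C) ∷ Κ 1ℚ ∷ [])
  (a Vec.∷ b Vec.∷ c Vec.∷ d Vec.∷ e Vec.∷ f Vec.∷ Vec.[]) refl
  where
  A B C D E F : Expr ℚ 6
  A = Ι 0F
  B = Ι 1F
  C = Ι 2F
  D = Ι 3F
  E = Ι 4F
  F = Ι 5F

-- Removes the leading constants of all factors at once: only their product enters, and comparing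
-- the coefficients at `n` shows that it is 1.
monic-scale : ∀ k p q n → coeff p n ≡ 1ℚ → coeff q n ≡ 1ℚ → p ≈ₚ map (k *_) q → p ≈ₚ q
monic-scale k p q n pₙ≡1 qₙ≡1 p≈kq m = trans (p≈kq m) (trans (coeff-scale k q m)
  (trans (cong (_* coeff q m) k≡1) (ℚ.*-identityˡ (coeff q m))))
  where
  open ≡-Reasoning
  k≡1 : k ≡ 1ℚ
  k≡1 = begin
    k                        ≡⟨ ℚ.*-identityʳ k ⟨
    k * 1ℚ                   ≡⟨ cong (k *_) qₙ≡1 ⟨
    k * coeff q n            ≡⟨ coeff-scale k q n ⟨
    coeff (map (k *_) q) n   ≡⟨ p≈kq n ⟨
    coeff p n                ≡⟨ pₙ≡1 ⟩
    1ℚ                       ∎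

⅓ : ℚ
⅓ = ℤ.+ 1 / 3

equal-constants : ∀ {A B a c f} → A ≢ 0ℚ → (∀ r → eval (f ∷ a ∷ 1ℚ ∷ []) r ≢ 0ℚ) →
  B ≡ f * f * f → A ≡ - (a * c * (a + c)) → f + f + f + (a * c + - (a + c) * (a + c)) ≡ 0ℚ →
  ∃[ u ] u ≢ 0ℚ × u ≢ - 1ℚ × u ≢ -½
    × EqualUpToScaling 6 3 A B (- (27ℚ * u * (u + 1ℚ))) (27ℚ * (u ^ 2 + u + 1ℚ) ^ 3)
equal-constants {A} {B} {a} {c} {f} A≢0 rootless B≡f³ A≡-ac[a+c] c₄ =
  u , u≢0 , u≢-1 , u≢-½ , s , s≢0 , A≡ , B≡
  where
  a≢0 : a ≢ 0ℚ
  a≢0 a≡0 = A≢0 (trans A≡-ac[a+c] (trans (cong (λ x → - (x * c * (x + c))) a≡0) (identity c)))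
    where
    identity : ∀ c → - (0ℚ * c * (0ℚ + c)) ≡ 0ℚ
    identity = solve-∀ ℚ-ring
  i s u : ℚ
  i = proj₁ (invert a≢0)
  -- Scaling by `a / 3` turns the first linear coefficient into 3. With `u = c / a` the other two
  -- become `3u` and `-3(u + 1)`.
  s = a * ⅓
  u = c * i
  ai≡1 : a * i ≡ 1ℚ
  ai≡1 = proj₂ (invert a≢0)
  a≡3s : a ≡ 3ℚ * s
  a≡3s = identity a
    where
    identity : ∀ a → a ≡ 3ℚ * (a * ⅓)
    identity = solve-∀ ℚ-ring
  s≢0 : s ≢ 0ℚ
  s≢0 s≡0 = a≢0 (trans a≡3s (cong (3ℚ *_) s≡0))
  c≡3us : c ≡ 3ℚ * u * s
  c≡3us = trans (sym (ℚ.*-identityʳ c)) (trans (cong (c *_) (sym ai≡1)) (identity a c i))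
    where
    identity : ∀ a c i → c * (a * i) ≡ 3ℚ * (c * i) * (a * ⅓)
    identity = solve-∀ ℚ-ring
  -- The equation `c₄` says `3 f = a² + a c + c²`.
  f≡ : f ≡ 3ℚ * (u ^ 2 + u + 1ℚ) * (s * s)
  f≡ = trans (identity₁ a c f) (trans (cong₂ (λ x y → ⅓ * (x + y)) c₄ (cong₂ (λ x y → x * x + x * y + y * y) a≡3s c≡3us)) (identity₂ u s))
    where
    identity₁ : ∀ a c f → f ≡ ⅓ * (f + f + f + (a * c + - (a + c) * (a + c)) + (a * a + a * c + c * c))
    identity₁ = solve-∀ ℚ-ring
    identity₂ : ∀ u s → ⅓ * (0ℚ + (3ℚ * s * (3ℚ * s) + 3ℚ * s * (3ℚ * u * s) + 3ℚ * u * s * (3ℚ * u * s)))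
                        ≡ 3ℚ * (u * (u * 1ℚ) + u + 1ℚ) * (s * s)
    identity₂ = solve-∀ ℚ-ring
  A≡ : A ≡ - (27ℚ * u * (u + 1ℚ)) * s ^ 3
  A≡ = trans A≡-ac[a+c] (trans (cong₂ (λ x y → - (x * y * (x + y))) a≡3s c≡3us) (identity u s))
    where
    identity : ∀ u s → - (3ℚ * s * (3ℚ * u * s) * (3ℚ * s + 3ℚ * u * s))
                       ≡ - (27ℚ * u * (u + 1ℚ)) * (s * (s * (s * 1ℚ)))
    identity = solve-∀ ℚ-ring
  B≡ : B ≡ 27ℚ * (u ^ 2 + u + 1ℚ) ^ 3 * s ^ 6
  B≡ = trans B≡f³ (trans (cong (λ x → x * x * x) f≡) (identity (u ^ 2 + u + 1ℚ) s))
    where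
    identity : ∀ v s → 3ℚ * v * (s * s) * (3ℚ * v * (s * s)) * (3ℚ * v * (s * s))
                       ≡ 27ℚ * (v * (v * (v * 1ℚ))) * (s * (s * (s * (s * (s * (s * 1ℚ))))))
    identity = solve-∀ ℚ-ring
  A-vanishes : ∀ {x} → u ≡ x → - (27ℚ * x * (x + 1ℚ)) ≡ 0ℚ → A ≡ 0ℚ
  A-vanishes u≡x e = trans A≡ (trans (cong (λ x → - (27ℚ * x * (x + 1ℚ)) * s ^ 3) u≡x)
    (trans (cong (_* s ^ 3) e) (ℚ.*-zeroˡ (s ^ 3))))
  u≢0 : u ≢ 0ℚ
  u≢0 u≡0 = A≢0 (A-vanishes u≡0 refl)
  u≢-1 : u ≢ - 1ℚ
  u≢-1 u≡-1 = A≢0 (A-vanishes u≡-1 refl)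
  u≢-½ : u ≢ -½
  -- At `u = -1/2` one has `f = a² / 4`, so the first quadratic is `(x + a/2)²`, with root
  -- `-a/2 = -3s/2`.
  u≢-½ u≡-½ = rootless (3ℚ * -½ * s)
    (trans (cong₂ (λ x y → eval (y ∷ x ∷ 1ℚ ∷ []) (3ℚ * -½ * s)) a≡3s
             (trans f≡ (cong (λ x → 3ℚ * (x ^ 2 + x + 1ℚ) * (s * s)) u≡-½)))
           (identity s))
    where
    identity : ∀ s → 3ℚ * (-½ * (-½ * 1ℚ) + -½ + 1ℚ) * (s * s)
                     + 3ℚ * -½ * s * (3ℚ * s + 3ℚ * -½ * s * (1ℚ + 3ℚ * -½ * s * 0ℚ)) ≡ 0ℚ
    identity = solve-∀ ℚ-ring

three-quadratics : ∀ {A B a b c d e f} → A ≢ 0ℚ → B ≢ 0ℚ →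
  (∀ r → eval (b ∷ a ∷ 1ℚ ∷ []) r ≢ 0ℚ) → (∀ r → eval (d ∷ c ∷ 1ℚ ∷ []) r ≢ 0ℚ) →
  (∀ r → eval (f ∷ e ∷ 1ℚ ∷ []) r ≢ 0ℚ) →
  B ≡ b * d * f → coeff₁ a b c d e f ≡ 0ℚ → coeff₂ a b c d e f ≡ 0ℚ →
  A ≡ a * (d + f) + c * (b + f) + e * (a * c + (b + d)) → coeff₄ a b c d e f ≡ 0ℚ → e ≡ - (a + c) →
  ∃[ u ] u ≢ 0ℚ × u ≢ - 1ℚ × u ≢ -½
    × EqualUpToScaling 6 3 A B (- (27ℚ * u * (u + 1ℚ))) (27ℚ * (u ^ 2 + u + 1ℚ) ^ 3)
three-quadratics {A} {B} {a} {b} {c} {d} {e} {f} A≢0 B≢0 rootless₁ rootless₂ rootless₃ B≡ c₁ c₂ A≡ c₄ refl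
  with quadratic-factors a b c d f f≢0 Q≢0 c₁ c₂ c₄
  where
  f≢0 : f ≢ 0ℚ
  f≢0 f≡0 = B≢0 (trans B≡ (trans (cong (b * d *_) f≡0) (ℚ.*-zeroʳ (b * d))))
  A-vanishes : a ≡ 0ℚ → c ≡ 0ℚ → A ≡ 0ℚ
  A-vanishes a≡0 c≡0 = trans A≡
    (trans (cong₂ (λ a c → a * (d + f) + c * (b + f) + - (a + c) * (a * c + (b + d))) a≡0 c≡0) (identity b d f))
    where
    identity : ∀ b d f → 0ℚ * (d + f) + 0ℚ * (b + f) + - (0ℚ + 0ℚ) * (0ℚ * 0ℚ + (b + d)) ≡ 0ℚ
    identity = solve-∀ ℚ-ring
  Q≢0 : a * a + a * c + c * c ≢ 0ℚ
  -- The form vanishes only at `a = c = 0`; then `e = 0` as well, and `A` would be zero.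
  Q≢0 Q≡0 with a ≟ 0ℚ | c ≟ 0ℚ
  ... | no a≢0  | _       = norm-≢0 c a≢0 Q≡0
  ... | yes _   | no c≢0  = norm-≢0 a c≢0 (trans (identity a c) Q≡0)
    where
    identity : ∀ a c → c * c + c * a + a * a ≡ a * a + a * c + c * c
    identity = solve-∀ ℚ-ring
  ... | yes a≡0 | yes c≡0 = A≢0 (A-vanishes a≡0 c≡0)
... | inj₁ (refl , refl) = equal-constants {A} {B} {a} {c} {f} A≢0 rootless₁ B≡ (trans A≡ (identity a c f)) c₄
  where
  identity : ∀ a c f → a * (f + f) + c * (f + f) + - (a + c) * (a * c + (f + f)) ≡ - (a * c * (a + c))
  identity = solve-∀ ℚ-ring
... | inj₂ (inj₁ b+c[a+c]≡0) = contradiction (trans (identity a b c) b+c[a+c]≡0) (rootless₁ c)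
  where
  identity : ∀ a b c → b + c * (a + c * (1ℚ + c * 0ℚ)) ≡ b + c * (a + c)
  identity = solve-∀ ℚ-ring
... | inj₂ (inj₂ (inj₁ d+a[a+c]≡0)) = contradiction (trans (identity a c d) d+a[a+c]≡0) (rootless₂ a)
  where
  identity : ∀ a c d → d + a * (c + a * (1ℚ + a * 0ℚ)) ≡ d + a * (a + c)
  identity = solve-∀ ℚ-ring
... | inj₂ (inj₂ (inj₂ refl)) = contradiction (identity a c) (rootless₃ a)
  where
  identity : ∀ a c → a * c + a * (- (a + c) + a * (1ℚ + a * 0ℚ)) ≡ 0ℚ
  identity = solve-∀ ℚ-ring

associate-rootless : ∀ {p n} → Irreducible p → HasDegree p (suc (suc n)) →
  ∀ k q → p ≈ₚ map (k *_) q → ∀ r → eval q r ≢ 0ℚ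
associate-rootless {p} irr deg k q p≈kq r root = irreducible-rootless {p} irr deg r
  (trans (eval-cong p (map (k *_) q) r p≈kq) (eval-scale-root k q r root))

type-222 : ∀ {A B} → A ≢ 0ℚ → B ≢ 0ℚ → HasReducibilityType (trinomial 6 3 A B) (2 ∷ 2 ∷ 2 ∷ []) →
  ∃[ u ] u ≢ 0ℚ × u ≢ - 1ℚ × u ≢ -½
    × EqualUpToScaling 6 3 A B (- (27ℚ * u * (u + 1ℚ))) (27ℚ * (u ^ 2 + u + 1ℚ) ^ 3)
type-222 {A} {B} A≢0 B≢0 record
  { factors = f₁ ∷ f₂ ∷ f₃ ∷ []
  ; irreducible = (irr₁ , deg₁) ∷ (irr₂ , deg₂) ∷ (irr₃ , deg₃) ∷ []
  ; factorizes = T≈f₁f₂f₃ } =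
  let k , a , b , f₁≈ = monic-quadratic {f₁} deg₁
      l , c , d , f₂≈ = monic-quadratic {f₂} deg₂
      m , e , f , f₃≈ = monic-quadratic {f₃} deg₃
      eq = coefficients k a b l c d m e f f₁≈ f₂≈ f₃≈
  in three-quadratics {A} {B} {a} {b} {c} {d} {e} {f} A≢0 B≢0
       (associate-rootless {f₁} irr₁ deg₁ k (b ∷ a ∷ 1ℚ ∷ []) f₁≈)
       (associate-rootless {f₂} irr₂ deg₂ l (d ∷ c ∷ 1ℚ ∷ []) f₂≈)
       (associate-rootless {f₃} irr₃ deg₃ m (f ∷ e ∷ 1ℚ ∷ []) f₃≈)
       (eq 0) (sym (eq 1)) (sym (eq 2)) (eq 3) (sym (eq 4))
       -- The absent `x⁵` term says `a + c + e = 0`.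
       (inverseˡ-unique e (a + c) (sym (eq 5)))
  where
  scaled-product : ∀ {p q} k l p′ q′ → p ≈ₚ map (k *_) p′ → q ≈ₚ map (l *_) q′ → p *ₚ q ≈ₚ map (k * l *_) (p′ *ₚ q′)
  scaled-product {p} {q} k l p′ q′ p≈ q≈ n =
    trans (*ₚ-cong {p} {map (k *_) p′} {q} {map (l *_) q′} p≈ q≈ n) (*ₚ-scale k l p′ q′ n)
  coefficients : ∀ k a b l c d m e f → f₁ ≈ₚ map (k *_) (b ∷ a ∷ 1ℚ ∷ []) →
    f₂ ≈ₚ map (l *_) (d ∷ c ∷ 1ℚ ∷ []) → f₃ ≈ₚ map (m *_) (f ∷ e ∷ 1ℚ ∷ []) → ∀ n →
    coeff (B ∷ 0ℚ ∷ 0ℚ ∷ A ∷ 0ℚ ∷ 0ℚ ∷ 1ℚ ∷ []) n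
      ≡ coeff (b * d * f ∷ coeff₁ a b c d e f ∷ coeff₂ a b c d e f
      ∷ a * (d + f) + c * (b + f) + e * (a * c + (b + d))
      ∷ coeff₄ a b c d e f ∷ e + (a + c) ∷ 1ℚ ∷ []) n
  coefficients k a b l c d m e f f₁≈ f₂≈ f₃≈ n = begin
    coeff (B ∷ 0ℚ ∷ 0ℚ ∷ A ∷ 0ℚ ∷ 0ℚ ∷ 1ℚ ∷ []) n  ≡⟨ cong (λ p → coeff p n) (trinomial-coefficients A B) ⟨
    coeff (trinomial 6 3 A B) n                    ≡⟨ monic-scale (k * (l * (m * 1ℚ))) (trinomial 6 3 A B) (productₚ (g₁ ∷ g₂ ∷ g₃ ∷ [])) 6
                                                        (cong (λ p → coeff p 6) (trinomial-coefficients A B))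
                                                        (cong (λ p → coeff p 6) (product-of-quadratics a b c d e f)) T≈ n ⟩
    coeff (productₚ (g₁ ∷ g₂ ∷ g₃ ∷ [])) n         ≡⟨ cong (λ p → coeff p n) (product-of-quadratics a b c d e f) ⟩
    _                                              ∎
    where
    open ≡-Reasoning
    g₁ g₂ g₃ : Poly
    g₁ = b ∷ a ∷ 1ℚ ∷ []
    g₂ = d ∷ c ∷ 1ℚ ∷ []
    g₃ = f ∷ e ∷ 1ℚ ∷ []
    -- The final `1ℚ` in the scalar belongs to the `const 1ℚ` that ends `productₚ`.
    T≈ : trinomial 6 3 A B ≈ₚ map (k * (l * (m * 1ℚ)) *_) (productₚ (g₁ ∷ g₂ ∷ g₃ ∷ []))
    T≈ n = trans (T≈f₁f₂f₃ n)
      (scaled-product {f₁} {f₂ *ₚ (f₃ *ₚ const 1ℚ)} k (l * (m * 1ℚ)) g₁ (g₂ *ₚ (g₃ *ₚ const 1ℚ)) f₁≈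
        (scaled-product {f₂} {f₃ *ₚ const 1ℚ} l (m * 1ℚ) g₂ (g₃ *ₚ const 1ℚ) f₂≈
          (scaled-product {f₃} {const 1ℚ} m 1ℚ g₃ (const 1ℚ) f₃≈ (λ n → sym (scale-1 (const 1ℚ) n)))) n)

-- The factorizations

-- Both sides are lists of exactly seven coefficients, so they agree propositionally and one solver
-- call settles every coefficient.
factorization-222 : ∀ u →
  trinomial 6 3 (- (27ℚ * u * (u + 1ℚ))) (27ℚ * (u ^ 2 + u + 1ℚ) ^ 3)
    ≡ (X^ 2 +ₚ 3ℚ ·X^ 1 +ₚ const (3ℚ * (u ^ 2 + u + 1ℚ)))
      *ₚ (X^ 2 -ₚ (3ℚ * (u + 1ℚ)) ·X^ 1 +ₚ const (3ℚ * (u ^ 2 + u + 1ℚ)))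
      *ₚ (X^ 2 +ₚ (3ℚ * u) ·X^ 1 +ₚ const (3ℚ * (u ^ 2 + u + 1ℚ)))
factorization-222 u = solveₚ
  (trinomialᴱ (⊝ (Κ 27ℚ ⊗ U ⊗ (U ⊕ Κ 1ℚ))) (Κ 27ℚ ⊗ (V ⊗ (V ⊗ (V ⊗ Κ 1ℚ)))))
  ((X² ⊞ Κ 3ℚ ·𝕏^ 1 ⊞ (Κ 3ℚ ⊗ V) ·𝕏^ 0)
    ⊠ (X² ⊞ map ⊝_ ((Κ 3ℚ ⊗ (U ⊕ Κ 1ℚ)) ·𝕏^ 1) ⊞ (Κ 3ℚ ⊗ V) ·𝕏^ 0)
    ⊠ (X² ⊞ (Κ 3ℚ ⊗ U) ·𝕏^ 1 ⊞ (Κ 3ℚ ⊗ V) ·𝕏^ 0))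
  (u Vec.∷ Vec.[]) refl
  where
  U V : Expr ℚ 1
  U = Ι 0F
  V = U ⊗ (U ⊗ Κ 1ℚ) ⊕ U ⊕ Κ 1ℚ
  X² : List (Expr ℚ 1)
  X² = Κ 1ℚ ·𝕏^ 2

factorization-1122 : ∀ u →
  trinomial 6 3 (- (u ^ 3) - 1ℚ) (u ^ 3)
    ≡ (X^ 1 -ₚ const 1ℚ) *ₚ (X^ 1 -ₚ const u) *ₚ (X^ 2 +ₚ X^ 1 +ₚ const 1ℚ)
      *ₚ (X^ 2 +ₚ u ·X^ 1 +ₚ const (u ^ 2))
factorization-1122 u = solveₚ
  (trinomialᴱ (⊝ U³ ⊕ ⊝ Κ 1ℚ) U³)
  ((X ⊞ map ⊝_ (Κ 1ℚ ·𝕏^ 0)) ⊠ (X ⊞ map ⊝_ (U ·𝕏^ 0)) ⊠ (X² ⊞ X ⊞ Κ 1ℚ ·𝕏^ 0)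
    ⊠ (X² ⊞ U ·𝕏^ 1 ⊞ (U ⊗ (U ⊗ Κ 1ℚ)) ·𝕏^ 0))
  (u Vec.∷ Vec.[]) refl
  where
  U U³ : Expr ℚ 1
  U = Ι 0F
  U³ = U ⊗ (U ⊗ (U ⊗ Κ 1ℚ))
  X X² : List (Expr ℚ 1)
  X = Κ 1ℚ ·𝕏^ 1
  X² = Κ 1ℚ ·𝕏^ 2

factorization-123 : ∀ t →
  trinomial 6 3 (t - 1ℚ) (- t)
    ≡ (X^ 1 -ₚ const 1ℚ) *ₚ (X^ 2 +ₚ X^ 1 +ₚ const 1ℚ) *ₚ (X^ 3 +ₚ const t)
factorization-123 t = solveₚ
  (trinomialᴱ (Ι 0F ⊕ ⊝ Κ 1ℚ) (⊝ Ι 0F))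
  ((X ⊞ map ⊝_ (Κ 1ℚ ·𝕏^ 0)) ⊠ (Κ 1ℚ ·𝕏^ 2 ⊞ X ⊞ Κ 1ℚ ·𝕏^ 0) ⊠ (Κ 1ℚ ·𝕏^ 3 ⊞ Ι 0F ·𝕏^ 0))
  (t Vec.∷ Vec.[]) refl
  where
  X : List (Expr ℚ 1)
  X = Κ 1ℚ ·𝕏^ 1

theorem4p4 : (A B : ℚ) → A * B ≢ 0ℚ →
    (HasReducibilityType (trinomial 6 3 A B) (2 ∷ 2 ∷ 2 ∷ []) →
    ∃[ u ] u ≢ 0ℚ × u ≢ - 1ℚ × u ≢ -½
    × EqualUpToScaling 6 3 A B (- (27ℚ * u * (u + 1ℚ))) (27ℚ * (u ^ 2 + u + 1ℚ) ^ 3)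
    × trinomial 6 3 (- (27ℚ * u * (u + 1ℚ))) (27ℚ * (u ^ 2 + u + 1ℚ) ^ 3)
    ≈ₚ (X^ 2 +ₚ 3ℚ ·X^ 1 +ₚ const (3ℚ * (u ^ 2 + u + 1ℚ)))
    *ₚ (X^ 2 -ₚ (3ℚ * (u + 1ℚ)) ·X^ 1 +ₚ const (3ℚ * (u ^ 2 + u + 1ℚ)))
    *ₚ (X^ 2 +ₚ (3ℚ * u) ·X^ 1 +ₚ const (3ℚ * (u ^ 2 + u + 1ℚ))))
    × (HasReducibilityType (trinomial 6 3 A B) (1 ∷ 1 ∷ 2 ∷ 2 ∷ []) →
    ∃[ u ] u ≢ 0ℚ × u ≢ - 1ℚ
    × EqualUpToScaling 6 3 A B (- (u ^ 3) - 1ℚ) (u ^ 3)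
    × trinomial 6 3 (- (u ^ 3) - 1ℚ) (u ^ 3)
    ≈ₚ (X^ 1 -ₚ const 1ℚ)
    *ₚ (X^ 1 -ₚ const u)
    *ₚ (X^ 2 +ₚ X^ 1 +ₚ const 1ℚ)
    *ₚ (X^ 2 +ₚ u ·X^ 1 +ₚ const (u ^ 2)))
    × ¬ HasReducibilityType (trinomial 6 3 A B) (1 ∷ 1 ∷ 1 ∷ 1 ∷ 2 ∷ [])
    × (HasReducibilityType (trinomial 6 3 A B) (1 ∷ 2 ∷ 3 ∷ []) →
    ∃[ t ] ¬ (∃[ v ] t ≡ v ^ 3)
    × EqualUpToScaling 6 3 A B (t - 1ℚ) (- t)
    × trinomial 6 3 (t - 1ℚ) (- t)
    ≈ₚ (X^ 1 -ₚ const 1ℚ)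
    *ₚ (X^ 2 +ₚ X^ 1 +ₚ const 1ℚ)
    *ₚ (X^ 3 +ₚ const t))
theorem4p4 A B AB≢0 = part₁ , part₂ , type-11112 {A} B≢0 , part₄
  where
  A≢0 : A ≢ 0ℚ
  A≢0 A≡0 = AB≢0 (trans (cong (_* B) A≡0) (ℚ.*-zeroˡ B))
  B≢0 : B ≢ 0ℚ
  B≢0 B≡0 = AB≢0 (trans (cong (A *_) B≡0) (ℚ.*-zeroʳ A))
  part₁ : _
  part₁ H = let u , u≢0 , u≢-1 , u≢-½ , scaling = type-222 A≢0 B≢0 H
            in u , u≢0 , u≢-1 , u≢-½ , scaling , λ n → cong (λ p → coeff p n) (factorization-222 u)
  part₂ : _
  part₂ H = let u , u≢0 , u≢-1 , scaling = type-1122 A≢0 B≢0 H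
            in u , u≢0 , u≢-1 , scaling , λ n → cong (λ p → coeff p n) (factorization-1122 u)
  part₄ : _
  part₄ H = let t , not-cube , scaling = type-123 B≢0 H
            in t , not-cube , scaling , λ n → cong (λ p → coeff p n) (factorization-123 t)
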